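{- Consider DIVIDE-THROW-RESIDUE. Then $\mathcal{SG}(n)=i_o(n)=k$, if $n= 2^m(2k-1)$, for some integer $m\ge 0$.
   Context: DIVIDE-THROW-RESIDUE is the impartial normal-play heap game where a move from a heap $n$ writes $n=kd+r$ with $1\le d<n$, $k\ge1$, $0\le r<d$, and moves to the disjunctive sum of $k$ heaps of size $d$ (the remainder $r$ is discarded); a heap of size $1$ is terminal. $\mathcal{SG}$ denotes the Sprague-Grundy value (mex rule, nim-sum for disjunctive sums). $i_o(n)$ is the index of the largest odd factor: $i_o(2^m(2k-1))=k$.
   Formalization: The heap n = 1 is excluded (n ≥ 2 is assumed), because a heap of size 1 is terminal, so SG(1) = 0, while i_o(1) = 1, and the printed formula fails there. -}

module Defs where

open import Data.Bool using (if_then_else_)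
open import Data.Fin using (Fin; toℕ; splitAt)
open import Data.Fin.Properties using (toℕ<n)
open import Data.List using (List; length; tabulate; filter; upTo; foldr)
open import Data.List.Membership.DecPropositional using (_∈?_)
open import Data.Nat using (ℕ; zero; suc; _+_; _⊔_; _<_; s≤s; ⌈_/2⌉)
open import Data.Nat.Divisibility using (_∣?_)
open import Data.Nat.DivMod using (_/_)
open import Data.Nat.Induction using (<-wellFounded)
open import Data.Nat.Properties using (_≟_)
open import Data.Sum using ([_,_]′)
open import Function using (_∘_)
open import Induction.WellFounded using (Acc; acc)
open import Relation.Nullary.Decidable using (does; ¬?; _×-dec_)

-- A finite impartial game, given by its (finitely many) options.
data Game : Set where
  node : (n : ℕ) → (Fin n → Game) → Game

terminal : Game
terminal = node 0 λ ()

-- Disjunctive sum: move in exactly one of the two components.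
infixr 6 _⊕_
_⊕_ : Game → Game → Game
node m f ⊕ node n g =
  node (m + n) ([ (λ i → f i ⊕ node n g) , (λ j → node m f ⊕ g j) ]′ ∘ splitAt m)

copies : ℕ → Game → Game
copies zero    G = terminal
copies (suc k) G = G ⊕ copies k G

-- The least natural number not in the list.  It is at most the length of the
-- list, so that many search steps suffice.
mex : List ℕ → ℕ
mex xs = search (length xs) 0
  where
  search : ℕ → ℕ → ℕ
  search zero       v = v
  search (suc fuel) v = if does (_∈?_ _≟_ v xs) then search fuel (suc v) else v

-- Sprague-Grundy value of an arbitrary game by the mex rule.  Nim-sum evaluation
-- of disjunctive sums is a theorem about this definition, not part of it.
grundy : Game → ℕ
grundy (node n f) = mex (tabulate (grundy ∘ f))

-- A heap of DIVIDE-THROW-RESIDUE.  A move chooses d = 1 + toℕ i with 1 ≤ d < n;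
-- the only k, r with n = k d + r and 0 ≤ r < d are k = n / d and r = n % d, and
-- k ≥ 1 because d < n.  The heap of size 0 is a junk value.
heapAcc : (n : ℕ) → Acc _<_ n → Game
heapAcc zero    _        = terminal
heapAcc (suc n) (acc rs) =
  node n λ i → copies (suc n / suc (toℕ i))
                      (heapAcc (suc (toℕ i)) (rs (s≤s (toℕ<n i))))

heap : ℕ → Game
heap n = heapAcc n (<-wellFounded n)

SG : ℕ → ℕ
SG n = grundy (heap n)

oddFactors : ℕ → List ℕ
oddFactors n = filter (λ d → (d ∣? n) ×-dec ¬? (2 ∣? d)) (upTo (suc n))

largestOddFactor : ℕ → ℕ
largestOddFactor n = foldr _⊔_ 0 (oddFactors n)

-- The odd number 2k - 1 has index k = ⌈ (2k - 1) / 2 ⌉.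
iₒ : ℕ → ℕ
iₒ n = ⌈ largestOddFactor n /2⌉

{-# OPTIONS --safe #-}

-- A position G + G + H has the same Grundy value as H: an option G' + G + H of
-- value SG(H) would itself have the option G' + G' + H, of the same value.
-- Hence k copies of a heap d are worth SG(d) for odd k and 0 for even k.
-- Let n = 2^j (2k - 1).  An option worth k would come from d = 2^i (2k - 1) with
-- i < j, but then n / d is even.  A value v with 0 < v < k is reached by the
-- unique d = 2^i (2v - 1) with n / 2 < d < n, as then n / d = 1; the value 0 is
-- reached by d = 1.
module Submission where

open import Data.Bool using (if_then_else_)
open import Data.Fin using (Fin; toℕ; fromℕ<; splitAt; _↑ˡ_; _↑ʳ_)
open import Data.Fin.Properties using (pigeonhole; splitAt-↑ˡ; splitAt-↑ʳ; toℕ<n; toℕ-fromℕ<)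
open import Data.List as List using (List; length; foldr; upTo)
open import Data.List.Membership.DecPropositional using (_∈?_)
open import Data.List.Membership.Propositional using (_∈_; _∉_)
open import Data.List.Membership.Propositional.Properties using (∈-tabulate⁺; ∈-tabulate⁻; ∈-filter⁺; ∈-filter⁻; ∈-upTo⁺)
open import Data.List.Membership.Setoid.Properties using (index-injective)
open import Data.List.Properties using (foldr-preservesᵇ; foldr-preservesᵒ)
open import Data.List.Relation.Unary.All using (tabulate)
open import Data.List.Relation.Unary.Any as Any using ()
open import Data.Nat using (ℕ; zero; suc; _+_; _*_; _∸_; _^_; _≤_; _<_; _≤′_; ≤′-refl; ≤′-step; _⊔_; s≤s; z≤n; z<s; NonZero; ⌈_/2⌉)
open import Data.Nat.Coprimality using (Coprime; coprime-divisor)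
open import Data.Nat.Divisibility using (_∣_; _∣?_; ∣⇒≤; n∣m*n; divides)
open import Data.Nat.DivMod using (_/_; m*n/n≡m; m<n*o⇒m/o<n; m≥n⇒m/n>0)
open import Data.Nat.Induction using (<-rec)
open import Data.Nat.Primality using (prime[2]; prime⇒irreducible)
open import Data.Nat.Properties
open import Data.Nat.Tactic.RingSolver using (solve-∀)
open import Data.Product using (_×_; _,_; ∃; ∃₂)
open import Data.Sum using (_⊎_; inj₁; inj₂; [_,_]′)
open import Function using (_∘_)
open import Induction.WellFounded using (Acc; acc)
open import Relation.Binary.Definitions using (tri<; tri≈; tri>)
open import Relation.Binary.PropositionalEquality using (_≡_; _≢_; refl; sym; trans; cong; subst; subst₂; setoid)
open import Relation.Nullary using (¬_; yes; no; contradiction)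
open import Relation.Nullary.Decidable using (does; ¬?; _×-dec_)
open import Defs

-- The mex rule

record IsMex (xs : List ℕ) (m : ℕ) : Set where
  field
    ∉-mex : m ∉ xs
    <-mex : ∀ {v} → v < m → v ∈ xs

-- The second hypothesis keeps the fuel sufficient: the numbers up to `fuel + v` are not all in
-- `xs`. A step of the search preserves this sum, and once the fuel is 0 the candidate `v` itself
-- must be missing.
SearchInvariant : List ℕ → ℕ → ℕ → ℕ → Set
SearchInvariant xs fuel v m =
  (∀ {u} → u < v → u ∈ xs) → ¬ (∀ {u} → u < suc (fuel + v) → u ∈ xs) → IsMex xs m

<-suc-∈ : ∀ {xs v} → v ∈ xs → (∀ {u} → u < v → u ∈ xs) → ∀ {u} → u < suc v → u ∈ xs
<-suc-∈ v∈ below u<1+v with m<1+n⇒m<n∨m≡n u<1+v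
... | inj₁ u<v  = below u<v
... | inj₂ refl = v∈

search-isMex : ∀ {xs} (search : ℕ → ℕ → ℕ) →
  (∀ v → search zero v ≡ v) →
  (∀ l v → search (suc l) v ≡ (if does (_∈?_ _≟_ v xs) then search l (suc v) else v)) →
  ∀ fuel v → SearchInvariant xs fuel v (search fuel v)
search-isMex search stop step zero v below ¬all rewrite stop v =
  record { ∉-mex = λ v∈ → ¬all (<-suc-∈ v∈ below) ; <-mex = below }
search-isMex {xs} search stop step (suc fuel) v below ¬all
  rewrite step fuel v with _∈?_ _≟_ v xs
... | yes v∈ = search-isMex search stop step fuel (suc v) (<-suc-∈ v∈ below)
                 (subst (λ l → ¬ (∀ {u} → u < suc l → u ∈ xs)) (sym (+-suc fuel v)) ¬all)
... | no  v∉ = record { ∉-mex = v∉ ; <-mex = below }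

-- The search inside mex is a local function without a name in scope; abstracting
-- its two arguments lets unification supply it.
mutual
  mexSearch : List ℕ → ℕ → ℕ → ℕ
  mexSearch = _

  mex-invariant : ∀ xs → SearchInvariant xs (length xs) 0 (mex xs)
  mex-invariant xs with length xs
  ... | fuel with 0
  ...   | v = search-isMex (mexSearch xs) (λ _ → refl) (λ _ _ → refl) fuel v

-- By pigeonhole two distinct numbers would occupy the same position of `xs`.
¬upTo-length-⊆ : ∀ xs → ¬ (∀ {u} → u < suc (length xs) → u ∈ xs)
¬upTo-length-⊆ xs all =
  let i , j , i<j , eq = pigeonhole (n<1+n _) (λ i → Any.index (all (toℕ<n i)))
  in <⇒≢ i<j (index-injective (setoid ℕ) (all (toℕ<n i)) (all (toℕ<n j)) eq)

mex-isMex : ∀ xs → IsMex xs (mex xs)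
mex-isMex xs = mex-invariant xs (λ ())
  (subst (λ l → ¬ (∀ {u} → u < suc l → u ∈ xs)) (sym (+-identityʳ _)) (¬upTo-length-⊆ xs))

-- Games and their options

infix 4 _⟶_
data _⟶_ : Game → Game → Set where
  move : ∀ {n f} (i : Fin n) → node n f ⟶ f i

⟶-induction : (P : Game → Set) → (∀ G → (∀ {G′} → G ⟶ G′ → P G′) → P G) → ∀ G → P G
⟶-induction P step (node n f) = step _ λ { (move i) → ⟶-induction P step (f i) }

⊕-moveˡ : ∀ {G G′} H → G ⟶ G′ → G ⊕ H ⟶ G′ ⊕ H
⊕-moveˡ (node n g) (move {m} {f} i) =
  subst (λ s → node m f ⊕ node n g ⟶ [ (λ i → f i ⊕ node n g) , (λ j → node m f ⊕ g j) ]′ s)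
        (splitAt-↑ˡ m i n) (move (i ↑ˡ n))

⊕-moveʳ : ∀ G {H H′} → H ⟶ H′ → G ⊕ H ⟶ G ⊕ H′
⊕-moveʳ (node m f) (move {n} {g} j) =
  subst (λ s → node m f ⊕ node n g ⟶ [ (λ i → f i ⊕ node n g) , (λ j → node m f ⊕ g j) ]′ s)
        (splitAt-↑ʳ m n j) (move (m ↑ʳ j))

⊕-elim : ∀ {G H} (P : Game → Set) →
  (∀ {G′} → G ⟶ G′ → P (G′ ⊕ H)) → (∀ {H′} → H ⟶ H′ → P (G ⊕ H′)) →
  ∀ {K} → G ⊕ H ⟶ K → P K
⊕-elim {node m f} {node n g} P left right (move i) with splitAt m i
... | inj₁ i′ = left (move i′)
... | inj₂ j  = right (move j)

record IsGrundy (G : Game) (g : ℕ) : Set where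
  field
    avoids  : ∀ {H} → G ⟶ H → grundy H ≢ g
    reaches : ∀ {v} → v < g → ∃ λ H → G ⟶ H × grundy H ≡ v

open IsGrundy

grundy-isGrundy : ∀ G → IsGrundy G (grundy G)
grundy-isGrundy (node n f) = record
  { avoids  = λ { (move i) eq → ∉-mex (subst (_∈ List.tabulate (grundy ∘ f)) eq (∈-tabulate⁺ {f = grundy ∘ f} i)) }
  ; reaches = λ v< → let i , eq = ∈-tabulate⁻ (<-mex v<) in f i , move i , sym eq
  }
  where open IsMex (mex-isMex (List.tabulate (grundy ∘ f)))

-- Were the two values different, the larger would require an option worth the smaller, which the
-- smaller forbids.
grundy-unique : ∀ {G g} → IsGrundy G g → grundy G ≡ g
grundy-unique {G} {g} is with <-cmp (grundy G) g
... | tri< lt _ _ = let _ , G⟶H , eq = reaches is lt in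
                    contradiction eq (avoids (grundy-isGrundy G) G⟶H)
... | tri≈ _ eq _ = eq
... | tri> _ _ gt = let _ , G⟶H , eq = reaches (grundy-isGrundy G) gt in
                    contradiction eq (avoids is G⟶H)

grundy-option-≢ : ∀ {G H g} → G ⟶ H → grundy H ≡ g → grundy G ≢ g
grundy-option-≢ {G} G⟶H eq eq′ = avoids (grundy-isGrundy G) G⟶H (trans eq (sym eq′))

grundy-⊕-terminal : ∀ G → grundy (G ⊕ terminal) ≡ grundy G
grundy-⊕-terminal = ⟶-induction _ λ G ih → grundy-unique record
  { avoids  = ⊕-elim (λ K → grundy K ≢ grundy G)
                (λ G⟶G′ eq → avoids (grundy-isGrundy G) G⟶G′ (trans (sym (ih G⟶G′)) eq))
                (λ { (move ()) })
  ; reaches = λ v< → let G′ , G⟶G′ , eq = reaches (grundy-isGrundy G) v< in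
                     G′ ⊕ terminal , ⊕-moveˡ terminal G⟶G′ , trans (ih G⟶G′) eq
  }

-- The outer induction on `G` holds for every `H`; the inner one on `H` keeps `G` fixed. A move in
-- either copy of `G` is answered by the same move in the other, while moves in `H` fall to the
-- inner hypothesis.
grundy-⊕-cancel : ∀ G H → grundy (G ⊕ (G ⊕ H)) ≡ grundy H
grundy-⊕-cancel = ⟶-induction _ λ G ihG → ⟶-induction _ λ H ihH → grundy-unique record
  { avoids  = ⊕-elim (λ K → grundy K ≢ grundy H)
                (λ {G′} G⟶G′ → grundy-option-≢ (⊕-moveʳ G′ (⊕-moveˡ H G⟶G′)) (ihG G⟶G′ H))
                (⊕-elim (λ K → grundy (G ⊕ K) ≢ grundy H)
                  (λ {G′} G⟶G′ → grundy-option-≢ (⊕-moveˡ (G′ ⊕ H) G⟶G′) (ihG G⟶G′ H))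
                  (λ H⟶H′ eq → avoids (grundy-isGrundy H) H⟶H′ (trans (sym (ihH H⟶H′)) eq)))
  ; reaches = λ v< → let H′ , H⟶H′ , eq = reaches (grundy-isGrundy H) v< in
                     G ⊕ (G ⊕ H′) , ⊕-moveʳ G (⊕-moveʳ G H⟶H′) , trans (ihH H⟶H′) eq
  }

grundy-copies-even : ∀ q G → grundy (copies (q * 2) G) ≡ 0
grundy-copies-even zero    G = refl
grundy-copies-even (suc q) G = trans (grundy-⊕-cancel G (copies (q * 2) G)) (grundy-copies-even q G)

grundy-copies : ∀ q G → grundy (copies q G) ≡ 0 ⊎ grundy (copies q G) ≡ grundy G
grundy-copies 0 G = inj₁ refl
grundy-copies 1 G = inj₂ (grundy-⊕-terminal G)
grundy-copies (suc (suc q)) G rewrite grundy-⊕-cancel G (copies q G) = grundy-copies q G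

-- Odd parts

even⊎odd : ∀ n → ∃ λ h → n ≡ 2 * h ⊎ n ≡ suc (2 * h)
even⊎odd zero = 0 , inj₁ refl
even⊎odd (suc n) with even⊎odd n
... | h , inj₁ eq = h , inj₂ (cong suc eq)
... | h , inj₂ eq = suc h , inj₁ (trans (cong suc eq) (sym (*-suc 2 h)))

odd-part : ∀ n → 1 ≤ n → ∃₂ λ i k → n ≡ 2 ^ i * suc (2 * k)
odd-part = <-rec _ step
  where
  step : ∀ n → (∀ {h} → h < n → 1 ≤ h → ∃₂ λ i k → h ≡ 2 ^ i * suc (2 * k)) →
         1 ≤ n → ∃₂ λ i k → n ≡ 2 ^ i * suc (2 * k)
  step n rec 1≤n with even⊎odd n
  ... | h , inj₂ eq = 0 , h , trans eq (sym (*-identityˡ _))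
  step _ rec () | zero , inj₁ refl
  ... | h@(suc h′) , inj₁ refl =
    let i , k , eq = rec (m<m+n h z<s) z<s in
    suc i , k , trans (cong (2 *_) eq) (sym (*-assoc 2 (2 ^ i) _))

odd-part-unique : ∀ i j {k l} → 2 ^ i * suc (2 * k) ≡ 2 ^ j * suc (2 * l) → k ≡ l
odd-part-unique zero zero eq =
  *-cancelˡ-≡ _ _ 2 (suc-injective (trans (sym (*-identityˡ _)) (trans eq (*-identityˡ _))))
odd-part-unique zero (suc j) {k} {l} eq =
  contradiction (trans (sym (*-assoc 2 (2 ^ j) _)) (trans (sym eq) (*-identityˡ _))) (even≢odd (2 ^ j * suc (2 * l)) k)
odd-part-unique (suc i) zero {k} {l} eq =
  contradiction (trans (sym (*-assoc 2 (2 ^ i) _)) (trans eq (*-identityˡ _))) (even≢odd (2 ^ i * suc (2 * k)) l)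
odd-part-unique (suc i) (suc j) eq = odd-part-unique i j
  (*-cancelˡ-≡ _ _ 2 (trans (sym (*-assoc 2 (2 ^ i) _)) (trans eq (*-assoc 2 (2 ^ j) _))))

2^-ratio-even : ∀ i j o → 2 ^ i * o < 2 ^ j * o → ∃ λ q → 2 ^ j * o ≡ q * 2 * (2 ^ i * o)
2^-ratio-even i j o lt with <-≤-connex i j
... | inj₂ j≤i = contradiction lt (≤⇒≯ (*-monoˡ-≤ o (^-monoʳ-≤ 2 j≤i)))
... | inj₁ i<j with m≤n⇒∃[o]m+o≡n i<j
-- Here `e` is `j - i - 1`, so the ratio `2 ^ (j - i)` is `2 ^ e * 2`.
...   | e , refl = 2 ^ e ,
  trans (cong (λ p → 2 * p * o) (^-distribˡ-+-* 2 i e)) (regroup (2 ^ i) (2 ^ e) o)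
  where
  regroup : ∀ x y z → 2 * (x * y) * z ≡ y * 2 * (x * z)
  regroup = solve-∀

-- Induction on `n` upwards from `a`, which is why `≤′` is used: the exponent stays until `n`
-- reaches the next doubling of `a`, and then grows by one.
doubling-bracket : ∀ {a n} → 1 ≤ a → a ≤′ n → ∃ λ i → 2 ^ i * a ≤ n × n < 2 * (2 ^ i * a)
doubling-bracket {a} 1≤a ≤′-refl =
  0 , ≤-reflexive (*-identityˡ a) , <-≤-trans (m<m+n a 1≤a) (≤-reflexive (double a))
  where
  double : ∀ a → a + a ≡ 2 * (1 * a)
  double = solve-∀
doubling-bracket {a} {suc n} 1≤a (≤′-step a≤n) with doubling-bracket 1≤a a≤n
... | i , lo , hi with m≤n⇒m<n∨m≡n hi
...   | inj₁ 1+n< = i , m≤n⇒m≤1+n lo , 1+n<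
...   | inj₂ eq   = suc i , ≤-reflexive (sym eq′) , <-≤-trans (m<m+n (suc n) z<s)
                      (≤-reflexive (trans (double (suc n)) (cong (2 *_) eq′)))
  where
  eq′ : suc n ≡ 2 ^ suc i * a
  eq′ = trans eq (sym (*-assoc 2 (2 ^ i) a))
  double : ∀ a → a + a ≡ 2 * a
  double = solve-∀

-- Heaps

-- The bound `2 ≤ n` excludes the terminal heap 1, whose value is 0 although its index is 1. The
-- index is shifted to `suc k`, which avoids truncated subtraction in the odd part.
HasOddIndexValue : ∀ {n} → Acc _<_ n → Set
HasOddIndexValue {n} a =
  ∀ j k → 2 ≤ n → n ≡ 2 ^ j * suc (2 * k) → grundy (heapAcc n a) ≡ suc k

grundy-heap-1 : (a : Acc _<_ 1) → grundy (heapAcc 1 a) ≡ 0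
grundy-heap-1 (acc _) = refl

grundy-copies-heap-1 : ∀ q (a : Acc _<_ 1) → grundy (copies q (heapAcc 1 a)) ≡ 0
grundy-copies-heap-1 q a with grundy-copies q (heapAcc 1 a)
... | inj₁ eq = eq
... | inj₂ eq = trans eq (grundy-heap-1 a)

-- Copies of heap 1 are worth 0. Otherwise a nonzero value is that of a single heap, so being worth
-- `suc k` forces the odd part of `n` on the divisor; the number of copies is then even and the
-- value 0 after all.
copies-heap-avoids : ∀ {n} d (a : Acc _<_ (suc d)) → HasOddIndexValue a → suc d < n →
  ∀ j k → n ≡ 2 ^ j * suc (2 * k) → grundy (copies (n / suc d) (heapAcc (suc d) a)) ≢ suc k
copies-heap-avoids {n} zero a ih d<n j k n≡ eq =
  contradiction (trans (sym (grundy-copies-heap-1 (n / 1) a)) eq) λ ()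
copies-heap-avoids {n} (suc d) a ih d<n j k n≡ eq
  with odd-part (suc (suc d)) z<s | grundy-copies (n / suc (suc d)) (heapAcc (suc (suc d)) a)
... | _          | inj₁ eq₀ = contradiction (trans (sym eq₀) eq) λ ()
... | i , l , d≡ | inj₂ eq₁ with suc-injective (trans (sym (ih i l (s≤s z<s) d≡)) (trans (sym eq₁) eq))
...   | refl =
  let q , ratio = 2^-ratio-even i j (suc (2 * k)) (subst₂ _<_ d≡ n≡ d<n)
      n/d≡      = trans (cong (_/ suc (suc d)) (trans n≡ (trans ratio (cong (q * 2 *_) (sym d≡)))))
                        (m*n/n≡m (q * 2) (suc (suc d)))
  in contradiction
       (trans (sym (grundy-copies-even q (heapAcc _ a))) (trans (cong (λ c → grundy (copies c (heapAcc _ a))) (sym n/d≡)) eq))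
       λ ()

quotient-1 : ∀ n d .{{_ : NonZero d}} → d ≤ n → n < 2 * d → n / d ≡ 1
quotient-1 n d d≤n n<2d = ≤-antisym (≤-pred (m<n*o⇒m/o<n n<2d)) (m≥n⇒m/n>0 d≤n)

-- The bracket applies because `2 * v + 1` is below the odd part of `n`. The divisor found differs
-- from `n`, since their odd parts differ.
odd-index-divisor : ∀ {n} j k → 2 ≤ n → n ≡ 2 ^ j * suc (2 * k) → ∀ v → v < k →
  ∃₂ λ d i → 2 ≤ suc d × suc d < n × suc d ≡ 2 ^ i * suc (2 * v) × n / suc d ≡ 1
odd-index-divisor {n} j k 2≤n n≡ v v<k
  with doubling-bracket {suc (2 * v)} {n} z<s (≤⇒≤′ (≤-trans (s≤s (*-monoʳ-≤ 2 (<⇒≤ v<k)))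
         (≤-trans (m≤n*m (suc (2 * k)) (2 ^ j) {{m^n≢0 2 j}}) (≤-reflexive (sym n≡)))))
... | i , lo , hi with 2 ^ i * suc (2 * v) in d≡
...   | zero        = contradiction hi λ ()
-- A divisor 1 would give `n < 2`.
...   | suc zero    = contradiction (≤-<-trans 2≤n hi) (<-irrefl refl)
...   | suc (suc d) = suc d , i , s≤s z<s , ≤∧≢⇒< lo d≢n , sym d≡ , quotient-1 n (suc (suc d)) lo hi
  where
  d≢n : suc (suc d) ≢ n
  d≢n eq = <⇒≢ v<k (odd-part-unique i j (trans d≡ (trans eq n≡)))

-- The value is requested for every index `i` with `toℕ i ≡ d`, so the heap and its accessibility
-- proof need no transport along that equation.
heap-move : ∀ {n d v} (rs : ∀ {y} → y < suc n → Acc _<_ y) → d < n →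
  (∀ i → toℕ i ≡ d → grundy (copies (suc n / suc (toℕ i)) (heapAcc (suc (toℕ i)) (rs (s≤s (toℕ<n i))))) ≡ v) →
  ∃ λ H → heapAcc (suc n) (acc rs) ⟶ H × grundy H ≡ v
heap-move rs d<n val = _ , move (fromℕ< d<n) , val (fromℕ< d<n) (toℕ-fromℕ< d<n)

grundy-heap : ∀ n (a : Acc _<_ n) → HasOddIndexValue a
grundy-heap (suc n) (acc rs) j k 2≤n n≡ = grundy-unique record
  { avoids  = λ { (move i) → copies-heap-avoids (toℕ i) _ (ih i) (s≤s (toℕ<n i)) j k n≡ }
  ; reaches = reach
  }
  where
  ih : (i : Fin n) → HasOddIndexValue (rs (s≤s (toℕ<n i)))
  ih i = grundy-heap (suc (toℕ i)) (rs (s≤s (toℕ<n i)))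

  reach : ∀ {v} → v < suc k → ∃ λ H → heapAcc (suc n) (acc rs) ⟶ H × grundy H ≡ v
  reach {zero} _ = heap-move rs (≤-pred 2≤n) λ i i≡0 → value _ i≡0 _
    where
    -- With `d` a variable in place of `toℕ i`, the equation can be matched with `refl`.
    value : ∀ d → d ≡ 0 → (a : Acc _<_ (suc d)) →
            grundy (copies (suc n / suc d) (heapAcc (suc d) a)) ≡ 0
    value _ refl = grundy-copies-heap-1 (suc n / 1)
  reach {suc v} v<k with odd-index-divisor j k 2≤n n≡ v (≤-pred v<k)
  ... | d , e , 2≤d , d<n , d≡ , n/d≡1 = heap-move rs (≤-pred d<n) λ i i≡d → value _ i≡d _ (ih i)
    where
    value : ∀ d′ → d′ ≡ d → (a : Acc _<_ (suc d′)) → HasOddIndexValue a →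
            grundy (copies (suc n / suc d′) (heapAcc (suc d′) a)) ≡ suc v
    value _ refl a val rewrite n/d≡1 =
      trans (grundy-⊕-terminal (heapAcc (suc d) a)) (val e v 2≤d d≡)

-- The largest odd factor

odd⇒coprime-2 : ∀ {d} → ¬ 2 ∣ d → Coprime d 2
odd⇒coprime-2 2∤d (c∣d , c∣2) with prime⇒irreducible prime[2] c∣2
... | inj₁ c≡1  = c≡1
... | inj₂ refl = contradiction c∣d 2∤d

-- Euclid's lemma removes one factor 2 at a time.
odd∣2^*⇒∣ : ∀ {d o} j → ¬ 2 ∣ d → d ∣ 2 ^ j * o → d ∣ o
odd∣2^*⇒∣ {d} {o} zero 2∤d d∣ = subst (d ∣_) (*-identityˡ o) d∣
odd∣2^*⇒∣ {d} {o} (suc j) 2∤d d∣ = odd∣2^*⇒∣ j 2∤d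
  (coprime-divisor (odd⇒coprime-2 2∤d) (subst (d ∣_) (*-assoc 2 (2 ^ j) o) d∣))

foldr-⊔-max : ∀ {x xs} → x ∈ xs → (∀ {y} → y ∈ xs → y ≤ x) → foldr _⊔_ 0 xs ≡ x
foldr-⊔-max {x} {xs} x∈xs ub = ≤-antisym
  (foldr-preservesᵇ ⊔-lub z≤n (tabulate ub))
  (foldr-preservesᵒ {P = x ≤_} (λ { a b (inj₁ x≤a) → m≤n⇒m≤n⊔o b x≤a ; a b (inj₂ x≤b) → m≤n⇒m≤o⊔n a x≤b })
    0 xs (inj₂ (Any.map ≤-reflexive x∈xs)))

2∤odd : ∀ k → ¬ 2 ∣ suc (2 * k)
2∤odd k (divides q eq) = even≢odd q k (trans (*-comm 2 q) (sym eq))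

-- The odd part is itself an odd divisor, and every odd divisor divides it.
largestOddFactor-2^* : ∀ j k → largestOddFactor (2 ^ j * suc (2 * k)) ≡ suc (2 * k)
largestOddFactor-2^* j k = foldr-⊔-max
  (∈-filter⁺ odd-factor? (∈-upTo⁺ (s≤s (m≤n*m o (2 ^ j) {{m^n≢0 2 j}}))) (n∣m*n (2 ^ j) , 2∤odd k))
  (λ y∈ → let _ , y∣n , 2∤y = ∈-filter⁻ odd-factor? {xs = upTo (suc (2 ^ j * o))} y∈ in ∣⇒≤ (odd∣2^*⇒∣ j 2∤y y∣n))
  where
  o = suc (2 * k)
  odd-factor? = λ d → (d ∣? (2 ^ j * o)) ×-dec ¬? (2 ∣? d)

⌈1+2*k/2⌉≡1+k : ∀ k → ⌈ suc (2 * k) /2⌉ ≡ suc k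
⌈1+2*k/2⌉≡1+k zero    = refl
⌈1+2*k/2⌉≡1+k (suc k) rewrite *-suc 2 k = cong suc (⌈1+2*k/2⌉≡1+k k)

iₒ-2^* : ∀ j k → iₒ (2 ^ j * suc (2 * k)) ≡ suc k
iₒ-2^* j k = trans (cong ⌈_/2⌉ (largestOddFactor-2^* j k)) (⌈1+2*k/2⌉≡1+k k)

mainTheorem11 : (n m k : ℕ) → 1 ≤ k → 2 ≤ n → n ≡ 2 ^ m * (2 * k ∸ 1) → (SG n ≡ iₒ n) × (iₒ n ≡ k)
mainTheorem11 n m (suc k) 1≤k 2≤n n≡ = trans (grundy-heap n _ m k 2≤n n≡′) (sym iₒ≡) , iₒ≡
  where
  n≡′ : n ≡ 2 ^ m * suc (2 * k)
  -- The term `2 * suc k ∸ 1` computes to `k + suc (k + 0)`.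
  n≡′ = trans n≡ (cong (2 ^ m *_) (+-suc k (k + 0)))
  iₒ≡ : iₒ n ≡ suc k
  iₒ≡ = trans (cong iₒ n≡′) (iₒ-2^* m k)
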